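{- Let $k \ge 2$ and $v$ be integers with $v \equiv 1 \pmod{k-1}$ and $v \ge k(k-1)^2 + k$. Then \[ \beta(1,v,k) = \frac{v-1}{k-1}. \]
   Context: For integers $v \ge k \ge 2$, a $(v,k)$-packing is a pair $(X,\mathcal{B})$ where $X$ is a set of $v$ points and $\mathcal{B}$ is a set of $k$-subsets of $X$ (blocks) such that every pair of distinct points lies in at most one block. A partial parallel class (PPC) is a set of pairwise disjoint blocks; its size is the number of blocks. A PPC of size $\rho$ is maximum if the packing has no PPC of size $\rho+1$. $\beta(\rho,v,k)$ denotes the maximum number of blocks in a $(v,k)$-packing in which the maximum PPC has size $\rho$; thus $\beta(1,v,k)$ is the maximum number of blocks in a $(v,k)$-packing with no two disjoint blocks. -}

module Defs where

open import Data.Fin using (Fin)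
open import Data.Fin.Subset using (Subset; _∈_; _∩_; ∣_∣; Empty)
open import Data.Integer as ℤ using (+_)
open import Data.Integer.Divisibility as ℤ using ()
open import Data.List using (List; length)
open import Data.List.Membership.Propositional using () renaming (_∈_ to _∈ₗ_)
open import Data.List.Relation.Unary.All using (All)
open import Data.List.Relation.Unary.AllPairs using (AllPairs)
open import Data.List.Relation.Unary.Unique.Propositional using (Unique)
open import Data.Nat using (ℕ; suc; _≤_; _∸_; NonZero; >-nonZero)
open import Data.Nat.Properties using (m<n⇒0<n∸m)
open import Data.Product using (Σ-syntax; _×_)
open import Relation.Binary.PropositionalEquality using (_≡_; _≢_)
open import Relation.Nullary using (¬_)

-- The point set is Fin v.  A finite set of blocks is a duplicate-free list,
-- so its cardinality is the length of the list.
record Packing (v k : ℕ) : Set where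
  field
    blocks     : List (Subset v)
    distinct   : Unique blocks
    uniform    : All (λ B → ∣ B ∣ ≡ k) blocks
    atMostOne  : ∀ {x y : Fin v} → x ≢ y →
                 ∀ {B C} → B ∈ₗ blocks → C ∈ₗ blocks →
                 x ∈ B → y ∈ B → x ∈ C → y ∈ C → B ≡ C

open Packing public

numBlocks : ∀ {v k} → Packing v k → ℕ
numBlocks 𝓟 = length (blocks 𝓟)

Disjoint : ∀ {v} → Subset v → Subset v → Set
Disjoint B C = Empty (B ∩ C)

record PartialParallelClass {v k} (𝓟 : Packing v k) (size : ℕ) : Set where
  field
    members   : List (Subset v)
    distinct  : Unique members
    areBlocks : All (_∈ₗ blocks 𝓟) members
    disjoint  : AllPairs Disjoint members
    hasSize   : length members ≡ size

MaximumPPCHasSize : ∀ {v k} → Packing v k → ℕ → Set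
MaximumPPCHasSize 𝓟 ρ =
  PartialParallelClass 𝓟 ρ × ¬ PartialParallelClass 𝓟 (suc ρ)

IsMaximumOf : (ℕ → Set) → ℕ → Set
IsMaximumOf P m = P m × (∀ n → P n → n ≤ m)

-- β is given by its graph, because for some ρ, v and k no packing has a
-- maximum partial parallel class of size ρ:  β[ ρ , v , k ]≡ b  asserts that
-- β(ρ, v, k) exists and equals b.
β[_,_,_]≡_ : ℕ → ℕ → ℕ → ℕ → Set
β[ ρ , v , k ]≡ b =
  IsMaximumOf
    (λ n → Σ[ 𝓟 ∈ Packing v k ] MaximumPPCHasSize 𝓟 ρ × numBlocks 𝓟 ≡ n)
    b

_≡_[mod_] : ℕ → ℕ → ℕ → Set
a ≡ b [mod n ] = (+ n) ℤ.∣ (+ a ℤ.- + b)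

k∸1-nonZero : ∀ {k} → 2 ≤ k → NonZero (k ∸ 1)
k∸1-nonZero 2≤k = >-nonZero (m<n⇒0<n∸m 2≤k)

{-# OPTIONS --safe #-}

-- Upper bound.  In an intersecting packing, a block missing a point x meets the
-- blocks through x in distinct points, so if x has degree greater than k then
-- every block contains x; the blocks are then disjoint outside x and there are
-- at most (v − 1)/(k − 1) of them.  If all degrees are at most k, counting the
-- incidences with the points of a fixed block gives at most k(k − 1) + 1 blocks,
-- which is no more than (v − 1)/(k − 1) since v ≥ k(k − 1)² + k.  The bound is
-- attained by a star: all blocks share a point and partition the others.
module Submission where

open import Defs
open import Data.Bool using (true; false; if_then_else_)
open import Data.Fin using (Fin; zero; suc; punchIn; quotient; splitAt)
open import Data.Fin.Properties using (any?; punchInᵢ≢i; 0≢1+n; suc-injective)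
open import Data.Fin.Subset
  using (Subset; inside; outside; ⊤; ⊥; _∈_; _∉_; _∩_; ∣_∣; Nonempty)
open import Data.Fin.Subset.Properties
  using (_∈?_; nonempty?; Empty-unique; ∣⊤∣≡n; ∣⊥∣≡0; x∈p∩q⁺; x∈p∩q⁻; drop-there)
open import Data.List as List using (List; []; _∷_; length)
open import Data.List.Membership.Propositional.Properties using (∈-lookup; ∈-tabulate⁺; ∈-tabulate⁻)
open import Data.List.Properties using (length-tabulate)
open import Data.List.Relation.Unary.All as All using ([]; _∷_)
import Data.List.Relation.Unary.All.Properties as All
open import Data.List.Relation.Unary.AllPairs using ([]; _∷_)
open import Data.List.Relation.Unary.Unique.Propositional using (Unique)
import Data.List.Relation.Unary.Unique.Propositional.Properties as Unique
open import Data.Nat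
  using (ℕ; zero; suc; s≤s; z≤n; NonZero; _<_; _≤?_; _≤_; _≥_; _+_; _*_; _∸_; _^_; _/_)
open import Data.Nat.Divisibility using (divides)
open import Data.Nat.DivMod using (m*n/n≡m; /-monoˡ-≤)
open import Data.Nat.Properties
  using ( ≤-refl; ≤-reflexive; ≤-trans; ≤-pred; <⇒≱; ≰⇒>; m≤m+n; m≤n+m; +-mono-≤; *-mono-≤
        ; *-monoˡ-≤; *-monoʳ-≤; +-cancelˡ-≤; +-comm; *-comm; *-identityˡ; *-identityʳ
        ; +-*-semiring; module ≤-Reasoning )
open import Data.Nat.Tactic.RingSolver using (solve-∀)
open import Data.Product using (_×_; _,_; ∃)
open import Data.Sum using (inj₁; inj₂)
open import Data.Vec using ([]; _∷_; _++_; here; there; lookup)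
open import Data.Vec.Functional using (removeAt)
open import Data.Vec.Properties using (lookup-splitAt; lookup-replicate; []=⇒lookup; lookup⇒[]=)
open import Function using (_∘_; const)
open import Relation.Binary.PropositionalEquality
  using (_≡_; _≢_; refl; sym; trans; cong; cong₂; subst; module ≡-Reasoning)
open import Relation.Nullary using (¬_; yes; no; contradiction)
open import Relation.Nullary.Decidable using (decidable-stable)

open import Algebra.Properties.Semiring.Sum +-*-semiring
  using (sum; sum-cong-≗; sum-remove; ∑-comm; *-distribˡ-sum; *-distribʳ-sum)

private
  variable
    n v k m r : ℕ

-- Finite sums of natural numbers.

sum-mono-≤ : {f g : Fin n → ℕ} → (∀ i → f i ≤ g i) → sum f ≤ sum g
sum-mono-≤ {n = zero}  f≤g = z≤n
sum-mono-≤ {n = suc n} f≤g = +-mono-≤ (f≤g zero) (sum-mono-≤ (f≤g ∘ suc))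

sum-const : ∀ n c → sum {n} (const c) ≡ n * c
sum-const zero    c = refl
sum-const (suc n) c = cong (c +_) (sum-const n c)

term≤sum : (f : Fin n → ℕ) → ∀ i → f i ≤ sum f
term≤sum f zero    = m≤m+n _ _
term≤sum f (suc i) = ≤-trans (term≤sum (f ∘ suc) i) (m≤n+m _ _)

-- A positive term at index `zero` forces all later terms to vanish, since a positive one would have
-- to sit at index `zero` too. Serves to turn uniqueness of a block into a bound on a count.
sum≤1 : (f : Fin n → ℕ) → (∀ i → f i ≤ 1) →
        (∀ {i j} → 1 ≤ f i → 1 ≤ f j → i ≡ j) → sum f ≤ 1
sum≤1 {zero}  f f≤1 unique = z≤n
sum≤1 {suc n} f f≤1 unique with f zero in eq
... | zero = sum≤1 (f ∘ suc) (f≤1 ∘ suc) (λ p q → suc-injective (unique p q))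
... | suc c = begin
  suc c + sum (f ∘ suc)      ≤⟨ +-mono-≤ (subst (_≤ 1) eq (f≤1 zero)) (sum-mono-≤ tail≤0) ⟩
  1 + sum {n} (const 0)      ≡⟨ cong suc (trans (sum-const n 0) (*-comm n 0)) ⟩
  1                          ∎
  where
  open ≤-Reasoning
  tail≤0 : ∀ i → f (suc i) ≤ 0
  tail≤0 i with f (suc i) in eqᵢ
  ... | zero  = z≤n
  ... | suc _ = contradiction
    (unique (subst (1 ≤_) (sym eq) (s≤s z≤n)) (subst (1 ≤_) (sym eqᵢ) (s≤s z≤n))) 0≢1+n

-- Double counting of incidences, with `M` as incidence matrix. The weight `a` selects blocks (those
-- through a point, or all of them), and `w` restricts the points to one fixed block.
sum-weighted-comm : (a : Fin n → ℕ) (w : Fin v → ℕ) (M : Fin n → Fin v → ℕ) →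
  sum (λ j → a j * sum (λ x → w x * M j x)) ≡ sum (λ x → w x * sum (λ j → a j * M j x))
sum-weighted-comm a w M = begin
  sum (λ j → a j * sum (λ x → w x * M j x))    ≡⟨ sum-cong-≗ (λ j → *-distribˡ-sum (a j) (λ x → w x * M j x)) ⟩
  sum (λ j → sum (λ x → a j * (w x * M j x)))  ≡⟨ ∑-comm (λ j x → a j * (w x * M j x)) ⟩
  sum (λ x → sum (λ j → a j * (w x * M j x)))  ≡⟨ sum-cong-≗ (λ x → sum-cong-≗ (λ j → swap (a j) (w x) (M j x))) ⟩
  sum (λ x → sum (λ j → w x * (a j * M j x)))  ≡⟨ sum-cong-≗ (λ x → *-distribˡ-sum (w x) (λ j → a j * M j x)) ⟨
  sum (λ x → w x * sum (λ j → a j * M j x))    ∎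
  where
  open ≡-Reasoning
  swap : ∀ a b c → a * (b * c) ≡ b * (a * c)
  swap = solve-∀

-- Indicator functions, which turn cardinalities and intersections into sums.

χ : Subset v → Fin v → ℕ
χ p x = if lookup p x then 1 else 0

χ-∈ : {p : Subset v} {x : Fin v} → x ∈ p → χ p x ≡ 1
χ-∈ x∈p rewrite []=⇒lookup x∈p = refl

χ-∉ : {p : Subset v} {x : Fin v} → x ∉ p → χ p x ≡ 0
χ-∉ {p = p} {x} x∉p with lookup p x in eq
... | true  = contradiction (lookup⇒[]= x p eq) x∉p
... | false = refl

χ≤1 : (p : Subset v) (x : Fin v) → χ p x ≤ 1
χ≤1 p x with lookup p x
... | true  = ≤-refl
... | false = z≤n

χ-idem : (p : Subset v) (x : Fin v) → χ p x * χ p x ≡ χ p x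
χ-idem p x with lookup p x
... | true  = refl
... | false = refl

χ*χ-pos : (p q : Subset v) (x y : Fin v) → 1 ≤ χ p x * χ q y → x ∈ p × y ∈ q
χ*χ-pos p q x y 1≤ with lookup p x in eq₁ | lookup q y in eq₂
... | true | true = lookup⇒[]= x p eq₁ , lookup⇒[]= y q eq₂

∣p∣≡∑χ : (p : Subset v) → ∣ p ∣ ≡ sum (χ p)
∣p∣≡∑χ []            = refl
∣p∣≡∑χ (inside ∷ p)  = cong suc (∣p∣≡∑χ p)
∣p∣≡∑χ (outside ∷ p) = ∣p∣≡∑χ p

∑χχ-pos : (p q : Subset v) → Nonempty (p ∩ q) → 1 ≤ sum (λ x → χ p x * χ q x)
∑χχ-pos p q (x , x∈p∩q) with x∈p∩q⁻ p q x∈p∩q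
... | x∈p , x∈q = begin
  1                          ≡⟨ cong₂ _*_ (χ-∈ x∈p) (χ-∈ x∈q) ⟨
  χ p x * χ q x              ≤⟨ term≤sum (λ x → χ p x * χ q x) x ⟩
  sum (λ x → χ p x * χ q x)  ∎
  where open ≤-Reasoning

-- Upper bounds for indexed families of blocks.

UniformFamily : ℕ → (Fin n → Subset v) → Set
UniformFamily k B = ∀ i → ∣ B i ∣ ≡ k

-- Concluding with equal indices rather than equal blocks also excludes repetition of a block with
-- at least two points.
LinearFamily : (Fin n → Subset v) → Set
LinearFamily B = ∀ {x y} → x ≢ y → ∀ {i j} → x ∈ B i → y ∈ B i → x ∈ B j → y ∈ B j → i ≡ j

IntersectingFamily : (Fin n → Subset v) → Set
IntersectingFamily B = ∀ {i j} → i ≢ j → Nonempty (B i ∩ B j)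

degree : (Fin n → Subset v) → Fin v → ℕ
degree B x = sum (λ j → χ (B j) x)

codegree≤1 : {B : Fin n → Subset v} → LinearFamily B → ∀ {x y} → x ≢ y →
             sum (λ j → χ (B j) x * χ (B j) y) ≤ 1
codegree≤1 {B = B} linear {x} {y} x≢y = sum≤1 _
  (λ j → *-mono-≤ (χ≤1 (B j) x) (χ≤1 (B j) y))
  (λ {i} {j} p q →
    let x∈Bᵢ , y∈Bᵢ = χ*χ-pos (B i) (B i) x y p
        x∈Bⱼ , y∈Bⱼ = χ*χ-pos (B j) (B j) x y q
    in linear x≢y x∈Bᵢ y∈Bᵢ x∈Bⱼ y∈Bⱼ)

-- Count pairs of a block through `x` and a point of `B i` on it. Each block through `x` differs
-- from `B i`, hence contributes at least one pair; each point `y` of `B i` differs from `x`, hence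
-- shares at most one block with it.
degree≤k : {B : Fin n → Subset v} → UniformFamily k B → LinearFamily B → IntersectingFamily B →
           ∀ {i x} → x ∉ B i → degree B x ≤ k
degree≤k {k = k} {B = B} uniform linear meet {i} {x} x∉Bᵢ = begin
  sum (λ j → χ (B j) x)                                          ≤⟨ sum-mono-≤ meets ⟩
  sum (λ j → χ (B j) x * sum (λ y → χ (B i) y * χ (B j) y))      ≡⟨ sum-weighted-comm (λ j → χ (B j) x) (χ (B i)) (χ ∘ B) ⟩
  sum (λ y → χ (B i) y * sum (λ j → χ (B j) x * χ (B j) y))      ≤⟨ sum-mono-≤ once ⟩
  sum (χ (B i))                                                  ≡⟨ ∣p∣≡∑χ (B i) ⟨
  ∣ B i ∣                                                        ≡⟨ uniform i ⟩
  k                                                              ∎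
  where
  open ≤-Reasoning
  meets : ∀ j → χ (B j) x ≤ χ (B j) x * sum (λ y → χ (B i) y * χ (B j) y)
  meets j with x ∈? B j
  ... | no x∉Bⱼ rewrite χ-∉ x∉Bⱼ = z≤n
  ... | yes x∈Bⱼ = begin
    χ (B j) x      ≡⟨ *-identityʳ _ ⟨
    χ (B j) x * 1  ≤⟨ *-monoʳ-≤ (χ (B j) x) (∑χχ-pos (B i) (B j) (meet λ { refl → x∉Bᵢ x∈Bⱼ })) ⟩
    _              ∎
  once : ∀ y → χ (B i) y * sum (λ j → χ (B j) x * χ (B j) y) ≤ χ (B i) y
  once y with y ∈? B i
  ... | no y∉Bᵢ rewrite χ-∉ y∉Bᵢ = z≤n
  ... | yes y∈Bᵢ = begin
    _              ≤⟨ *-monoʳ-≤ (χ (B i) y) (codegree≤1 linear (λ { refl → x∉Bᵢ y∈Bᵢ })) ⟩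
    χ (B i) y * 1  ≡⟨ *-identityʳ _ ⟩
    χ (B i) y      ∎

-- Add up the degrees of the `k` points of `B zero`: that block meets itself in `k` points and each
-- of the other `n` blocks in at least one. Keeping `k` on the left avoids truncated subtraction.
boundedDegree⇒size≤ : {B : Fin (suc n) → Subset v} → UniformFamily k B → IntersectingFamily B →
                      (∀ x → degree B x ≤ k) → k + n ≤ k * k
boundedDegree⇒size≤ {n = n} {k = k} {B = B} uniform meet deg≤k = begin
  k + n                                                            ≡⟨ cong₂ _+_ inner₀₀ (trans (sum-const n 1) (*-identityʳ n)) ⟨
  inner zero + sum {n} (const 1)                                   ≤⟨ +-mono-≤ ≤-refl (sum-mono-≤ (λ j → ∑χχ-pos (B zero) (B (suc j)) (meet 0≢1+n))) ⟩
  sum inner                                                        ≡⟨ sum-cong-≗ (λ j → *-identityˡ (inner j)) ⟨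
  sum (λ j → 1 * inner j)                                          ≡⟨ sum-weighted-comm (const 1) (χ (B zero)) (χ ∘ B) ⟩
  sum (λ x → χ (B zero) x * sum (λ j → 1 * χ (B j) x))             ≡⟨ sum-cong-≗ (λ x → cong (χ (B zero) x *_) (sum-cong-≗ (λ j → *-identityˡ (χ (B j) x)))) ⟩
  sum (λ x → χ (B zero) x * degree B x)                            ≤⟨ sum-mono-≤ (λ x → *-monoʳ-≤ (χ (B zero) x) (deg≤k x)) ⟩
  sum (λ x → χ (B zero) x * k)                                     ≡⟨ *-distribʳ-sum k (χ (B zero)) ⟨
  sum (χ (B zero)) * k                                             ≡⟨ cong (_* k) (trans (sym (∣p∣≡∑χ (B zero))) (uniform zero)) ⟩
  k * k                                                            ∎
  where
  open ≤-Reasoning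
  inner : Fin (suc n) → ℕ
  inner j = sum (λ x → χ (B zero) x * χ (B j) x)
  inner₀₀ : inner zero ≡ k
  inner₀₀ = trans (sum-cong-≗ (χ-idem (B zero))) (trans (sym (∣p∣≡∑χ (B zero))) (uniform zero))

-- Deleting the common point `x` leaves `n` pairwise disjoint sets of size `m` among the remaining
-- `v` points, which `punchIn x` enumerates.
star⇒size≤ : {B : Fin n → Subset (suc v)} → UniformFamily (suc m) B → LinearFamily B →
             ∀ {x} → (∀ i → x ∈ B i) → n * m ≤ v
star⇒size≤ {n = n} {v = v} {m = m} {B = B} uniform linear {x} x∈B = begin
  n * m                                        ≡⟨ sum-const n m ⟨
  sum {n} (const m)                            ≡⟨ sum-cong-≗ rest ⟨
  sum (λ i → sum (removeAt (χ (B i)) x))       ≡⟨ ∑-comm (λ i → removeAt (χ (B i)) x) ⟩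
  sum (λ y → sum (λ i → χ (B i) (punchIn x y))) ≤⟨ sum-mono-≤ once ⟩
  sum {v} (const 1)                            ≡⟨ trans (sum-const v 1) (*-identityʳ v) ⟩
  v                                            ∎
  where
  open ≤-Reasoning
  rest : ∀ i → sum (removeAt (χ (B i)) x) ≡ m
  rest i = cong (_∸ 1) (begin-equality
    1 + sum (removeAt (χ (B i)) x)          ≡⟨ cong (_+ sum (removeAt (χ (B i)) x)) (χ-∈ (x∈B i)) ⟨
    χ (B i) x + sum (removeAt (χ (B i)) x)  ≡⟨ sum-remove (χ (B i)) ⟨
    sum (χ (B i))                           ≡⟨ ∣p∣≡∑χ (B i) ⟨
    ∣ B i ∣                                 ≡⟨ uniform i ⟩
    suc m                                   ∎)
  once : ∀ y → sum (λ i → χ (B i) (punchIn x y)) ≤ 1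
  once y = begin
    -- Every block contains `x`, so the factor 1 may be replaced by `χ (B i) x`; the degree of the
    -- other point becomes its codegree with `x`.
    sum (λ i → χ (B i) (punchIn x y))              ≡⟨ sum-cong-≗ (λ i → *-identityˡ (χ (B i) (punchIn x y))) ⟨
    sum (λ i → 1 * χ (B i) (punchIn x y))          ≡⟨ sum-cong-≗ (λ i → cong (_* χ (B i) (punchIn x y)) (χ-∈ (x∈B i))) ⟨
    sum (λ i → χ (B i) x * χ (B i) (punchIn x y))  ≤⟨ codegree≤1 linear (punchInᵢ≢i x y ∘ sym) ⟩
    1                                              ∎

intersecting⇒size≤ : {B : Fin n → Subset (suc v)} →
  UniformFamily (suc m) B → LinearFamily B → IntersectingFamily B →
  suc m * m ^ 2 + suc m ≤ suc v → n * m ≤ v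
intersecting⇒size≤ {n = zero} _ _ _ _ = z≤n
intersecting⇒size≤ {n = suc n} {v = v} {m = m} {B = B} uniform linear meet large
  -- With `k` equal to `suc m`, the threshold is `k + 1`: one more than a point missed by some block
  -- can reach.
  with any? (λ x → suc (suc m) ≤? degree B x)
... | yes (x , deg>k) = star⇒size≤ uniform linear
      (λ i → decidable-stable (x ∈? B i) (λ x∉Bᵢ → <⇒≱ deg>k (degree≤k uniform linear meet x∉Bᵢ)))
... | no deg≯k = ≤-pred (begin
      -- The family has `suc n` blocks, at most `k(k - 1) + 1`. Multiplying by `m` and adding 1
      -- gives exactly the lower bound assumed for the number of points.
      suc (suc n * m)            ≤⟨ s≤s (*-monoˡ-≤ m (s≤s n≤)) ⟩
      suc (suc (m * suc m) * m)  ≡⟨ regroup m ⟩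
      suc m * m ^ 2 + suc m      ≤⟨ large ⟩
      suc v                      ∎)
  where
  open ≤-Reasoning
  deg≤k : ∀ x → degree B x ≤ suc m
  deg≤k x = ≤-pred (≰⇒> (λ deg>k → deg≯k (x , deg>k)))
  n≤ : n ≤ m * suc m
  n≤ = +-cancelˡ-≤ (suc m) n (m * suc m) (boundedDegree⇒size≤ uniform meet deg≤k)
  regroup : ∀ m → suc (suc (m * suc m) * m) ≡ suc m * (m * (m * 1)) + suc m
  regroup = solve-∀

-- From packings to indexed families.

lookup-injective : {A : Set} {xs : List A} → Unique xs →
                   ∀ {i j} → List.lookup xs i ≡ List.lookup xs j → i ≡ j
lookup-injective (x∉ ∷ xs!) {zero}  {zero}  eq = refl
lookup-injective (x∉ ∷ xs!) {zero}  {suc j} eq = contradiction eq (All.lookup x∉ (∈-lookup j))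
lookup-injective (x∉ ∷ xs!) {suc i} {zero}  eq = contradiction (sym eq) (All.lookup x∉ (∈-lookup i))
lookup-injective (x∉ ∷ xs!) {suc i} {suc j} eq = cong suc (lookup-injective xs! eq)

noTwoDisjoint⇒numBlocks≤ : (𝓟 : Packing (suc v) (suc m)) → ¬ PartialParallelClass 𝓟 2 →
  suc m * m ^ 2 + suc m ≤ suc v → numBlocks 𝓟 * m ≤ v
noTwoDisjoint⇒numBlocks≤ 𝓟 no2 = intersecting⇒size≤ {B = B}
  (λ i → All.lookup (uniform 𝓟) (∈-lookup i))
  (λ x≢y {i} {j} p q r s →
    lookup-injective (distinct 𝓟) (atMostOne 𝓟 x≢y (∈-lookup i) (∈-lookup j) p q r s))
  -- Two blocks without a common point would form a partial parallel class of size 2.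
  (λ {i} {j} i≢j → decidable-stable (nonempty? (B i ∩ B j)) (λ disjoint → no2 record
    { members   = B i ∷ B j ∷ []
    ; distinct  = ((i≢j ∘ lookup-injective (distinct 𝓟)) ∷ []) ∷ [] ∷ []
    ; areBlocks = ∈-lookup i ∷ ∈-lookup j ∷ []
    ; disjoint  = (disjoint ∷ []) ∷ [] ∷ []
    ; hasSize   = refl
    }))
  where
  B : Fin (numBlocks 𝓟) → Subset _
  B = List.lookup (blocks 𝓟)

-- The star packing.

∣p++q∣≡∣p∣+∣q∣ : (p : Subset n) (q : Subset v) → ∣ p ++ q ∣ ≡ ∣ p ∣ + ∣ q ∣
∣p++q∣≡∣p∣+∣q∣ []            q = refl
∣p++q∣≡∣p∣+∣q∣ (inside ∷ p)  q = cong suc (∣p++q∣≡∣p∣+∣q∣ p q)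
∣p++q∣≡∣p∣+∣q∣ (outside ∷ p) q = ∣p++q∣≡∣p∣+∣q∣ p q

-- Consecutive intervals of length `m`. The recursion splits off the first `m` points, just as
-- `quotient` does.
part : ∀ m → Fin r → Subset (r * m)
part {suc r} m zero    = ⊤ {m} ++ ⊥ {r * m}
part {suc r} m (suc i) = ⊥ {m} ++ part m i

∣part∣≡m : ∀ m (i : Fin r) → ∣ part m i ∣ ≡ m
∣part∣≡m {suc r} m zero = begin
  ∣ ⊤ {m} ++ ⊥ {r * m} ∣        ≡⟨ ∣p++q∣≡∣p∣+∣q∣ (⊤ {m}) ⊥ ⟩
  ∣ ⊤ {m} ∣ + ∣ ⊥ {r * m} ∣     ≡⟨ cong₂ _+_ (∣⊤∣≡n m) (∣⊥∣≡0 (r * m)) ⟩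
  m + 0                         ≡⟨ +-comm m 0 ⟩
  m                             ∎
  where open ≡-Reasoning
∣part∣≡m m (suc i) =
  trans (∣p++q∣≡∣p∣+∣q∣ (⊥ {m}) (part m i)) (cong₂ _+_ (∣⊥∣≡0 m) (∣part∣≡m m i))

-- Any single point determines the part containing it; this yields both disjointness of the parts
-- and, when they are nonempty, their distinctness.
quotient-part : ∀ m (i : Fin r) {x} → x ∈ part m i → quotient m x ≡ i
quotient-part {suc r} m zero {x} x∈
  with splitAt m x | trans (sym (lookup-splitAt m ⊤ ⊥ x)) ([]=⇒lookup x∈)
... | inj₁ y | _  = refl
... | inj₂ y | eq = contradiction (trans (sym (lookup-replicate y outside)) eq) λ ()
quotient-part {suc r} m (suc i) {x} x∈
  with splitAt m x | trans (sym (lookup-splitAt m ⊥ (part m i) x)) ([]=⇒lookup x∈)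
... | inj₁ y | eq = contradiction (trans (sym (lookup-replicate y outside)) eq) λ ()
... | inj₂ y | eq = cong suc (quotient-part m i (lookup⇒[]= y (part m i) eq))

∣p∣>0⇒Nonempty : (p : Subset v) → 0 < ∣ p ∣ → Nonempty p
∣p∣>0⇒Nonempty {v} p 0<∣p∣ = decidable-stable (nonempty? p) λ empty →
  <⇒≱ 0<∣p∣ (≤-reflexive (trans (cong ∣_∣ (Empty-unique empty)) (∣⊥∣≡0 v)))

starBlock : ∀ m → Fin r → Subset (suc (r * m))
starBlock m i = inside ∷ part m i

-- Positivity of `m` supplies a point of the part other than the centre `zero`; for `m` equal to 0
-- all blocks would collapse to the centre.
starBlock-injective : ∀ {m} → 0 < m → {i j : Fin r} → starBlock m i ≡ starBlock m j → i ≡ j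
starBlock-injective {m = m} 0<m {i} {j} eq
  with ∣p∣>0⇒Nonempty (part m i) (subst (0 <_) (sym (∣part∣≡m m i)) 0<m)
... | x , x∈ = trans (sym (quotient-part m i x∈))
                     (quotient-part m j (drop-there (subst (suc x ∈_) eq (there x∈))))

-- Of two distinct points at least one is not the centre, and that one determines the block.
starBlock-linear : ∀ m → LinearFamily (starBlock {r} m)
starBlock-linear m {zero}  {zero}  x≢y                 = contradiction refl x≢y
starBlock-linear m {suc x} {_}     _   {i} {j} p _ q _ =
  trans (sym (quotient-part m i (drop-there p))) (quotient-part m j (drop-there q))
starBlock-linear m {zero}  {suc y} _   {i} {j} _ p _ q =
  trans (sym (quotient-part m i (drop-there p))) (quotient-part m j (drop-there q))

starPacking : ∀ r m → 0 < m → Packing (suc (r * m)) (suc m)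
starPacking r m 0<m = record
  { blocks    = List.tabulate (starBlock {r} m)
  ; distinct  = Unique.tabulate⁺ (starBlock-injective 0<m)
  ; uniform   = All.tabulate⁺ (λ i → cong suc (∣part∣≡m m i))
  ; atMostOne = λ x≢y B∈ C∈ → same x≢y (∈-tabulate⁻ B∈) (∈-tabulate⁻ C∈)
  }
  where
  same : ∀ {x y} → x ≢ y → ∀ {B C} →
         (∃ λ i → B ≡ starBlock {r} m i) → (∃ λ i → C ≡ starBlock {r} m i) →
         x ∈ B → y ∈ B → x ∈ C → y ∈ C → B ≡ C
  same x≢y (i , refl) (j , refl) p q s t = cong (starBlock {r} m) (starBlock-linear m x≢y {i} {j} p q s t)

starPacking-maximumPPC : ∀ r m (0<m : 0 < m) → MaximumPPCHasSize (starPacking (suc r) m 0<m) 1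
starPacking-maximumPPC r m 0<m = single , noTwo
  where
  single : PartialParallelClass (starPacking (suc r) m 0<m) 1
  single = record
    { members   = starBlock {suc r} m zero ∷ []
    ; distinct  = [] ∷ []
    ; areBlocks = ∈-tabulate⁺ {f = starBlock {suc r} m} zero ∷ []
    ; disjoint  = [] ∷ []
    ; hasSize   = refl
    }
  noTwo : ¬ PartialParallelClass (starPacking (suc r) m 0<m) 2
  -- Any two blocks share the centre `zero`, so they cannot be disjoint.
  noTwo record { members = B ∷ C ∷ [] ; areBlocks = B∈ ∷ C∈ ∷ [] ; disjoint = (B∥C ∷ []) ∷ _ }
    with ∈-tabulate⁻ {f = starBlock {suc r} m} B∈ | ∈-tabulate⁻ {f = starBlock {suc r} m} C∈
  ... | i , refl | j , refl = B∥C (zero , x∈p∩q⁺ (here , here))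

-- The exact value.

β-star : ∀ r m .{{_ : NonZero m}} → 0 < m → suc m * m ^ 2 + suc m ≤ suc (suc r * m) →
         β[ 1 , suc (suc r * m) , suc m ]≡ (suc r * m / m)
β-star r m 0<m large =
    ( starPacking (suc r) m 0<m
    , starPacking-maximumPPC r m 0<m
    , trans (length-tabulate (starBlock {suc r} m)) (sym (m*n/n≡m (suc r) m)) )
  -- The upper bound in product form, `numBlocks 𝓟 * m ≤ suc r * m`, is divided by `m`.
  , λ { _ (𝓟 , (_ , no2) , refl) →
        subst (_≤ suc r * m / m) (m*n/n≡m (numBlocks 𝓟) m)
          (/-monoˡ-≤ m (noTwoDisjoint⇒numBlocks≤ 𝓟 no2 large)) }

theorem5p5 : (k v : ℕ) (2≤k : 2 ≤ k) →
    v ≡ 1 [mod (k ∸ 1) ] →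
    v ≥ k * (k ∸ 1) ^ 2 + k →
    β[ 1 , v , k ]≡ (_/_ (v ∸ 1) (k ∸ 1) {{k∸1-nonZero 2≤k}})
theorem5p5 (suc m) zero 2≤k _ large =
  contradiction (≤-trans (m≤n+m (suc m) (suc m * m ^ 2)) large) λ ()
theorem5p5 (suc m) (suc v) (s≤s 0<m) v≡1 large with v≡1
-- The congruence computes to `v ≡ q * m` for the predecessor `v` of the number of points. Quotient
-- 0 would leave a single point, fewer than the block size.
... | divides zero refl =
  contradiction (≤-trans (s≤s 0<m) (≤-trans (m≤n+m (suc m) (suc m * m ^ 2)) large)) λ { (s≤s ()) }
... | divides (suc r) refl = β-star r m {{k∸1-nonZero (s≤s 0<m)}} 0<m large
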